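{- If $T$ is a monochromatic tree of order $n\ge 2$, then $pc_{opt}(T)=n-2-\alpha'(T)+\Delta(T)$.
   Context: $\alpha'(T)$ denotes the size of a maximum matching of $T$ and $\Delta(T)$ its maximum degree. An edge-colored graph is properly colored if no two adjacent edges share a color; an edge-colored connected graph is properly connected if between every pair of distinct vertices there is a properly colored path. A monochromatic graph is one in which every edge has color $0$; any color $i\neq 0$ is a new color. For a monochromatic connected graph $G$, $pc_{opt}(G)$ is the minimum of $p+q$ over all ways to make $G$ properly connected by recoloring $p$ edges of $G$ using $q$ new colors. -}

module Defs where

open import Data.Bool using (Bool; true; false; T; _∧_; not)
open import Data.Nat using (ℕ; zero; suc; _+_; _≤_; _⊔_; _<ᵇ_)
open import Data.Fin using (Fin; toℕ)
open import Data.Fin.Properties using () renaming (_≟_ to _≟ᶠ_)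
open import Data.List using (List; []; _∷_; _++_; length; map; foldr; filterᵇ; allFin; cartesianProduct; concatMap)
open import Data.List.Relation.Unary.All using (All)
open import Data.List.Relation.Unary.Unique.Propositional using (Unique)
open import Data.Product using (Σ; _×_; _,_; ∃)
open import Data.Unit using (⊤)
open import Data.Empty using (⊥)
open import Relation.Nullary using (¬_; does)
open import Relation.Binary.PropositionalEquality using (_≡_; _≢_)

record Graph (n : ℕ) : Set where
  field
    adj   : Fin n → Fin n → Bool
    sym   : ∀ i j → adj i j ≡ adj j i
    irrefl : ∀ i → adj i i ≡ false
open Graph public

Adj : ∀ {n} → Graph n → Fin n → Fin n → Set
Adj G i j = T (adj G i j)

edges : ∀ {n} → Graph n → List (Fin n × Fin n)
edges {n} G = filterᵇ (λ { (i , j) → (toℕ i <ᵇ toℕ j) ∧ adj G i j })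
                      (cartesianProduct (allFin n) (allFin n))

degree : ∀ {n} → Graph n → Fin n → ℕ
degree {n} G v = length (filterᵇ (adj G v) (allFin n))

Δ : ∀ {n} → Graph n → ℕ
Δ {n} G = foldr _⊔_ 0 (map (degree G) (allFin n))

IsWalk : ∀ {n} → Graph n → List (Fin n) → Set
IsWalk G []             = ⊤
IsWalk G (x ∷ [])       = ⊤
IsWalk G (x ∷ y ∷ rest) = Adj G x y × IsWalk G (y ∷ rest)

-- a path from u to v (u ≠ v is forced by Unique): vertices u, mid..., v
IsPathBetween : ∀ {n} → Graph n → Fin n → Fin n → List (Fin n) → Set
IsPathBetween G u v xs =
  Σ (List _) λ mid → xs ≡ u ∷ mid ++ v ∷ [] × Unique xs × IsWalk G xs

Connected : ∀ {n} → Graph n → Set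
Connected {n} G = ∀ (u v : Fin n) → u ≢ v → ∃ λ xs → IsPathBetween G u v xs

IsCycle : ∀ {n} → Graph n → List (Fin n) → Set
IsCycle G []                  = ⊥
IsCycle G (x ∷ [])            = ⊥
IsCycle G (x ∷ y ∷ [])        = ⊥
IsCycle G xs@(x ∷ y ∷ z ∷ rest) =
  Unique xs × IsWalk G xs × Adj G (lastOf z rest) x
  where
  lastOf : _ → List _ → _
  lastOf a []       = a
  lastOf a (b ∷ bs) = lastOf b bs

Acyclic : ∀ {n} → Graph n → Set
Acyclic G = ∀ xs → ¬ IsCycle G xs

IsTree : ∀ {n} → Graph n → Set
IsTree G = Connected G × Acyclic G

endpoints : ∀ {n} → List (Fin n × Fin n) → List (Fin n)
endpoints = concatMap (λ { (i , j) → i ∷ j ∷ [] })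

IsMatching : ∀ {n} → Graph n → List (Fin n × Fin n) → Set
IsMatching G M = All (λ { (i , j) → Adj G i j }) M × Unique (endpoints M)

IsMatchingNumber : ∀ {n} → Graph n → ℕ → Set
IsMatchingNumber G a =
  (Σ _ λ M → IsMatching G M × length M ≡ a) ×
  (∀ M → IsMatching G M → length M ≤ a)

-- Edge colourings.  A recolouring of the monochromatic graph G with q
-- new colours is a symmetric colour function with values in
-- {0,1,…,q} (Fin (suc q)); 0 is the original colour, 1..q are new.

record Recolouring {n} (G : Graph n) (q : ℕ) : Set where
  field
    col    : Fin n → Fin n → Fin (suc q)
    colSym : ∀ i j → col i j ≡ col j i
open Recolouring public

recoloured : ∀ {n} {G : Graph n} {q} → Recolouring G q → ℕ
recoloured {G = G} c =
  length (filterᵇ (λ { (i , j) → not (does (col c i j ≟ᶠ Data.Fin.zero)) }) (edges G))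

ProperlyColouredSeq : ∀ {n} {G : Graph n} {q} → Recolouring G q → List (Fin n) → Set
ProperlyColouredSeq c (x ∷ y ∷ z ∷ rest) =
  col c x y ≢ col c y z × ProperlyColouredSeq c (y ∷ z ∷ rest)
ProperlyColouredSeq c _ = ⊤

ProperlyConnected : ∀ {n} {G : Graph n} {q} → Recolouring G q → Set
ProperlyConnected {n} {G} c =
  ∀ (u v : Fin n) → u ≢ v →
    ∃ λ xs → IsPathBetween G u v xs × ProperlyColouredSeq c xs

IsPcOpt : ∀ {n} → Graph n → ℕ → Set
IsPcOpt G k =
  (Σ ℕ λ q → Σ (Recolouring G q) λ c →
      ProperlyConnected c × recoloured c + q ≡ k) ×
  (∀ q (c : Recolouring G q) → ProperlyConnected c → k ≤ recoloured c + q)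

{-# OPTIONS --safe #-}
module Submission where

-- A tree is properly connected exactly when adjacent edges differ in colour:
-- then the edges of colour 0 form a matching, and a vertex of maximum degree
-- sees Δ colours, so p ≥ n − 1 − α′ and q ≥ Δ − 1.  For equality, root the tree
-- and push the uncovered vertices of a maximum matching downwards until it
-- covers every vertex with a child.  Colour it 0 and colour the remaining edges
-- from the root downwards with Δ − 1 further colours: as every parent has an
-- edge of colour 0, these suffice.

open import Defs
open import Data.Nat using (ℕ; _+_; _≤_)
open import Data.Product using (Σ; _×_)
open import Relation.Binary.PropositionalEquality using (_≡_)
open import Data.Bool using (Bool; true; false; T; not; if_then_else_)
open import Data.Bool.Properties using (T?; T-∧)
open import Data.Empty using (⊥; ⊥-elim)
open import Data.Fin using (Fin; toℕ; inject≤) renaming (zero to fzero; suc to fsuc)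
open import Data.Fin.Permutation.Components using (transpose; transpose-inverse)
open import Data.Fin.Properties using (toℕ-injective; injective⇒≤; inject≤-injective; all?; any?; ¬∀⟶∃¬) renaming (_≟_ to _≟ᶠ_)
open import Data.List using (List; []; _∷_; [_]; _++_; length; map; foldr; lookup; filterᵇ; allFin; cartesianProduct)
import Data.List.Membership.DecPropositional as DecMembership
open import Data.List.Membership.Propositional using (_∈_; _∉_)
open import Data.List.Membership.Propositional.Properties using (∈-lookup; ∈-allFin; ∈-filter⁺; ∈-filter⁻; ∈-map⁺; ∈-map⁻; ∈-cartesianProduct⁺; ∈-++⁻; ∈-∃++)
open import Data.List.Properties using (length-map; ++-assoc; length-tabulate)
open import Data.List.Relation.Binary.Permutation.Propositional using (_↭_; ↭-refl; ↭-prep; ↭-swap; ↭-trans; ↭-sym; ↭⇒↭ₛ)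
open import Data.List.Relation.Binary.Permutation.Propositional.Properties using (∈-resp-↭; shifts) renaming (map⁺ to ↭-map)
import Data.List.Relation.Binary.Permutation.Setoid.Properties as SetoidPerm
open import Data.List.Relation.Binary.Subset.Propositional using (_⊆_)
open import Data.List.Relation.Unary.All as All using (All; []; _∷_)
import Data.List.Relation.Unary.All.Properties as All
open import Data.List.Relation.Unary.AllPairs as AllPairs using (AllPairs; []; _∷_)
import Data.List.Relation.Unary.AllPairs.Properties as AllPairs
open import Data.List.Relation.Unary.Any as Any using (here; there)
open import Data.List.Relation.Unary.Any.Properties using (lookup-index)
open import Data.List.Relation.Unary.Unique.Propositional using (Unique)
open import Data.List.Relation.Unary.Unique.Propositional.Properties using (allFin⁺; cartesianProduct⁺; filter⁺)
open import Data.Nat using (zero; suc; _*_; _<_; _⊔_; z≤n; s≤s)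
open import Data.Nat.Induction using (<-wellFounded)
open import Data.Nat.ListAction using (sum)
open import Data.Nat.ListAction.Properties using (sum-↭)
import Data.Nat.Properties as ℕ
open import Data.Nat.Solver using (module +-*-Solver)
open import Data.Product using (∃; ∃₂; _,_; proj₁; proj₂)
open import Data.Sum using (_⊎_; inj₁; inj₂)
open import Data.Unit using (tt)
open import Function using (_∘_; id; Equivalence)
open import Induction.WellFounded using (Acc; acc)
open import Relation.Binary.Definitions using (tri<; tri≈; tri>)
open import Relation.Binary.PropositionalEquality using (_≢_; refl; cong; trans; subst; subst₂; setoid; module ≡-Reasoning) renaming (sym to ≡-sym)
open import Relation.Nullary using (¬_; Dec; yes; no; does)
open import Relation.Nullary.Decidable using (_×-dec_; ¬?; decidable-stable; dec-true; dec-false)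

-- The two lower bounds compete: an arbitrary maximum matching can leave a vertex of degree Δ
-- uncovered, and that vertex then needs Δ new colours. On the path 1-2-3-4-5 the matching {12, 45}
-- does this at 3, while {12, 34} needs only one new colour. Hence the detour through a matching
-- that misses only childless vertices. Pushing works because an uncovered v with a child u forces u
-- to have a mate x below it: exchanging ux for vu keeps the size, uncovers x instead of v, and
-- lowers the sum of the depths of the covered vertices. In the colouring, each vertex has two
-- prescriptions: its mate's edge gets 0, and the edge to its parent keeps the colour chosen there.
-- They could clash only if the parent used 0 on an edge outside the matching; a covered parent has
-- already spent 0 on its own mate.

allPairs-map∈ : {A : Set} {R S : A → A → Set} {xs : List A} →
  (∀ {x y} → x ∈ xs → y ∈ xs → R x y → S x y) → AllPairs R xs → AllPairs S xs
allPairs-map∈ f []         = []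
allPairs-map∈ f (px ∷ pxs) =
  All.tabulate (λ y∈ → f (here refl) (there y∈) (All.lookup px y∈)) ∷
  allPairs-map∈ (λ x∈ y∈ → f (there x∈) (there y∈)) pxs

unique-map : {A B : Set} (f : A → B) {xs : List A} →
  (∀ {x y} → x ∈ xs → y ∈ xs → f x ≡ f y → x ≡ y) → Unique xs → Unique (map f xs)
unique-map f inj xs! = AllPairs.map⁺ (allPairs-map∈ (λ x∈ y∈ x≢y → x≢y ∘ inj x∈ y∈) xs!)

lookup-injective : {A : Set} {xs : List A} → Unique xs →
  ∀ {i j} → lookup xs i ≡ lookup xs j → i ≡ j
lookup-injective (px ∷ xs!) {fzero}  {fzero}  eq = refl
lookup-injective (px ∷ xs!) {fzero}  {fsuc j} eq = ⊥-elim (All.lookup px (∈-lookup j) eq)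
lookup-injective (px ∷ xs!) {fsuc i} {fzero}  eq = ⊥-elim (All.lookup px (∈-lookup i) (≡-sym eq))
lookup-injective (px ∷ xs!) {fsuc i} {fsuc j} eq = cong fsuc (lookup-injective xs! eq)

index-injective : {A : Set} {xs : List A} {x y : A} (x∈ : x ∈ xs) (y∈ : y ∈ xs) →
  Any.index x∈ ≡ Any.index y∈ → x ≡ y
index-injective {xs = xs} x∈ y∈ eq =
  trans (lookup-index x∈) (trans (cong (lookup xs) eq) (≡-sym (lookup-index y∈)))

unique-⊆⇒length≤ : {A : Set} {xs ys : List A} → Unique xs → xs ⊆ ys → length xs ≤ length ys
unique-⊆⇒length≤ xs! xs⊆ys = injective⇒≤ {f = λ i → Any.index (xs⊆ys (∈-lookup i))}
  (λ eq → lookup-injective xs! (index-injective (xs⊆ys (∈-lookup _)) (xs⊆ys (∈-lookup _)) eq))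

length-allFin : ∀ n → length (allFin n) ≡ n
length-allFin n = length-tabulate {n = n} id

unique⇒length≤ : ∀ {n} {xs : List (Fin n)} → Unique xs → length xs ≤ n
unique⇒length≤ {n} {xs} xs! =
  subst (length xs ≤_) (length-allFin n) (unique-⊆⇒length≤ xs! (λ {x} _ → ∈-allFin x))

complete⇒length≥ : ∀ {n} {xs : List (Fin n)} → (∀ x → x ∈ xs) → n ≤ length xs
complete⇒length≥ {n} {xs} all∈ =
  subst (_≤ length xs) (length-allFin n) (unique-⊆⇒length≤ (allFin⁺ n) (λ {x} _ → all∈ x))

length-filter-complement : {A : Set} (p : A → Bool) (xs : List A) →
  length (filterᵇ (not ∘ p) xs) + length (filterᵇ p xs) ≡ length xs
length-filter-complement p [] = refl
length-filter-complement p (x ∷ xs) with p x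
... | true  = trans (ℕ.+-suc _ _) (cong suc (length-filter-complement p xs))
... | false = cong suc (length-filter-complement p xs)

∈⇒≤max : ∀ {xs m} → m ∈ xs → m ≤ foldr _⊔_ 0 xs
∈⇒≤max (here refl)          = ℕ.m≤m⊔n _ _
∈⇒≤max {x ∷ xs} (there m∈) = ℕ.≤-trans (∈⇒≤max m∈) (ℕ.m≤n⊔m x _)

max≤ : ∀ {xs b} → (∀ {m} → m ∈ xs → m ≤ b) → foldr _⊔_ 0 xs ≤ b
max≤ {[]}     h = z≤n
max≤ {x ∷ xs} h = ℕ.⊔-lub (h (here refl)) (max≤ {xs} (h ∘ there))

-- Adjacency, degrees and the edge list

module _ {n : ℕ} (G : Graph n) where

  adj-sym : ∀ {u v} → Adj G u v → Adj G v u
  adj-sym {u} {v} = subst T (sym G u v)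

  adj⇒≢ : ∀ {u v} → Adj G u v → u ≢ v
  adj⇒≢ {u} a refl = subst T (irrefl G u) a

  neighbours : Fin n → List (Fin n)
  neighbours v = filterᵇ (adj G v) (allFin n)

  neighbours-unique : ∀ v → Unique (neighbours v)
  neighbours-unique v = filter⁺ (T? ∘ adj G v) (allFin⁺ n)

  ∈-neighbours : ∀ {v u} → Adj G v u → u ∈ neighbours v
  ∈-neighbours {v} {u} = ∈-filter⁺ (T? ∘ adj G v) (∈-allFin u)

  ∈-neighbours⁻ : ∀ {v u} → u ∈ neighbours v → Adj G v u
  ∈-neighbours⁻ {v} = proj₂ ∘ ∈-filter⁻ (T? ∘ adj G v) {xs = allFin n}

  degree≤Δ : ∀ v → degree G v ≤ Δ G
  degree≤Δ v = ∈⇒≤max (∈-map⁺ (degree G) (∈-allFin v))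

  1≤degree : ∀ {v u} → Adj G v u → 1 ≤ degree G v
  1≤degree a = unique-⊆⇒length≤ ([] ∷ []) (λ { (here refl) → ∈-neighbours a })

  Δ≤ : ∀ {b} → (∀ v → degree G v ≤ b) → Δ G ≤ b
  Δ≤ {b} h = max≤ {map (degree G) (allFin n)} λ m∈ → let (v , _ , eq) = ∈-map⁻ (degree G) m∈ in subst (_≤ b) (≡-sym eq) (h v)

  edges-unique : Unique (edges G)
  edges-unique = filter⁺ _ (cartesianProduct⁺ (allFin⁺ n) (allFin⁺ n))

  ∈-edges⁻ : ∀ {i j} → (i , j) ∈ edges G → toℕ i < toℕ j × Adj G i j
  ∈-edges⁻ {i} {j} e∈ =
    let (lt , a) = Equivalence.to T-∧ (proj₂ (∈-filter⁻ _ {xs = cartesianProduct (allFin n) (allFin n)} e∈))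
    in ℕ.<ᵇ⇒< (toℕ i) (toℕ j) lt , a

  ∈-edges⁺ : ∀ {i j} → toℕ i < toℕ j → Adj G i j → (i , j) ∈ edges G
  ∈-edges⁺ {i} {j} lt a =
    ∈-filter⁺ _ (∈-cartesianProduct⁺ (∈-allFin i) (∈-allFin j)) (Equivalence.from T-∧ (ℕ.<⇒<ᵇ lt , a))

  adj⇒∈-edges : ∀ {u v} → Adj G u v → (u , v) ∈ edges G ⊎ (v , u) ∈ edges G
  adj⇒∈-edges {u} {v} a with ℕ.<-cmp (toℕ u) (toℕ v)
  ... | tri< lt _ _ = inj₁ (∈-edges⁺ lt a)
  ... | tri≈ _ eq _ = ⊥-elim (adj⇒≢ a (toℕ-injective eq))
  ... | tri> _ _ gt = inj₂ (∈-edges⁺ gt (adj-sym a))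

-- Paths, cycles and growing a rooted spanning tree

endOf : {A : Set} → A → List A → A
endOf z []       = z
endOf z (b ∷ bs) = endOf b bs

endOf-∷ʳ : {A : Set} (z : A) (xs : List A) (w : A) → endOf z (xs ++ [ w ]) ≡ w
endOf-∷ʳ z []       w = refl
endOf-∷ʳ z (b ∷ xs) w = endOf-∷ʳ b xs w

ThirdComponent : {A B C S : Set} → S ≡ (A × B × C) → Set
ThirdComponent {C = C} _ = C

override : {n : ℕ} {A : Set} → (Fin n → A) → Fin n → A → Fin n → A
override f v y u = if does (u ≟ᶠ v) then y else f u

override-≡ : {n : ℕ} {A : Set} (f : Fin n → A) (v : Fin n) (y : A) → override f v y v ≡ y
override-≡ f v y with v ≟ᶠ v
... | yes _ = refl
... | no v≢ = ⊥-elim (v≢ refl)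

override-≢ : {n : ℕ} {A : Set} (f : Fin n → A) {v u : Fin n} (y : A) → u ≢ v → override f v y u ≡ f u
override-≢ f {v} {u} y u≢v with u ≟ᶠ v
... | yes eq = ⊥-elim (u≢v eq)
... | no _   = refl

unique-∷ʳ : {A : Set} {xs : List A} {v : A} → Unique xs → v ∉ xs → Unique (xs ++ [ v ])
unique-∷ʳ {v = v} xs! v∉ = AllPairs.++⁺ xs! ([] ∷ []) (All.tabulate (λ x∈ → (λ { refl → v∉ x∈ }) ∷ []))

unique-split : {A : Set} (xs : List A) (b : A) (ys : List A) →
  Unique (xs ++ b ∷ ys) → Unique (xs ++ [ b ]) × Unique (b ∷ ys)
unique-split []       b ys p! = [] ∷ [] , p!
unique-split (x ∷ xs) b ys (x∉ ∷ p!) with unique-split xs b ys p! | All.++⁻ xs x∉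
... | p₁ , p₂ | ∉xs , x≢b ∷ _ = All.++⁺ ∉xs (x≢b ∷ []) ∷ p₁ , p₂

module _ {n : ℕ} (G : Graph n) where

  open DecMembership (_≟ᶠ_ {n}) using (_∈?_)

  -- The closing edge of IsCycle is stated with a local function of Defs that
  -- cannot be named here, so its type is read off by unification.
  ClosingEdge : Fin n → Fin n → Fin n → List (Fin n) → Set
  ClosingEdge x y z rest = ThirdComponent {S = IsCycle G (x ∷ y ∷ z ∷ rest)} refl

  closingEdge : ∀ x y z rest → Adj G (endOf z rest) x → ClosingEdge x y z rest
  closingEdge x y z []         a = a
  closingEdge x y z (b ∷ rest) a = closingEdge x y b rest a

  -- The explicit second vertex `m` supplies the three vertices that `IsCycle` demands.
  isCycle : ∀ u m mid {w} → Unique (u ∷ m ∷ mid ++ [ w ]) → IsWalk G (u ∷ m ∷ mid ++ [ w ]) →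
    Adj G w u → IsCycle G (u ∷ m ∷ mid ++ [ w ])
  isCycle u m []      {w} p! walk a = p! , walk , a
  isCycle u m (z ∷ r) {w} p! walk a =
    p! , walk , closingEdge u m z (r ++ [ w ]) (subst (λ e → Adj G e u) (≡-sym (endOf-∷ʳ z r w)) a)

  walk-∷ʳ : ∀ a mid {b c} → IsWalk G (a ∷ mid ++ [ b ]) → Adj G b c → IsWalk G ((a ∷ mid ++ [ b ]) ++ [ c ])
  walk-∷ʳ a []      (ab , _) bc = ab , bc , tt
  walk-∷ʳ a (m ∷ r) (am , w) bc = am , walk-∷ʳ m r w bc

  walk-split : ∀ a xs b ys → IsWalk G (a ∷ xs ++ b ∷ ys) → IsWalk G (a ∷ xs ++ [ b ]) × IsWalk G (b ∷ ys)
  walk-split a []       b ys (ab , w) = (ab , tt) , w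
  walk-split a (m ∷ xs) b ys (am , w) = let (w₁ , w₂) = walk-split m xs b ys w in (am , w₁) , w₂

  walk-leaves : ∀ {L} a mid {b} → IsWalk G (a ∷ mid ++ [ b ]) → a ∈ L → b ∉ L →
    ∃₂ λ x y → x ∈ L × y ∉ L × Adj G x y
  walk-leaves a []      (ab , _) a∈ b∉ = _ , _ , a∈ , b∉ , ab
  walk-leaves {L} a (m ∷ r) (am , w) a∈ b∉ with m ∈? L
  ... | yes m∈ = walk-leaves m r w m∈ b∉
  ... | no m∉  = _ , _ , a∈ , m∉ , am

  PathIn : List (Fin n) → Fin n → Fin n → Set
  PathIn L a b = Σ (List (Fin n)) λ mid →
    Unique (a ∷ mid ++ [ b ]) × IsWalk G (a ∷ mid ++ [ b ]) × All (_∈ L) (a ∷ mid ++ [ b ])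

  -- A rooted structure on the vertices `L` reached so far. Acyclicity is stored in `adj-parent`: no
  -- edge inside `L` other than the parent edges. The field `path` is carried along to prove this
  -- for each new vertex, and its paths stay in `L` so that an outside vertex is fresh to them.
  record Rooted (root : Fin n) (L : List (Fin n)) : Set where
    field
      parent      : Fin n → Fin n
      depth       : Fin n → ℕ
      root∈       : root ∈ L
      unique      : Unique L
      parent-in   : ∀ {v} → v ∈ L → v ≢ root → parent v ∈ L
      parent-root : parent root ≡ root
      parent-adj  : ∀ {v} → v ∈ L → v ≢ root → Adj G v (parent v)
      depth-<     : ∀ {v} → v ∈ L → v ≢ root → depth (parent v) < depth v
      adj-parent  : ∀ {u v} → u ∈ L → v ∈ L → Adj G u v → parent v ≡ u ⊎ parent u ≡ v
      path        : ∀ {a b} → a ∈ L → b ∈ L → a ≢ b → PathIn L a b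

  singleton : ∀ r → Rooted r [ r ]
  singleton r = record
    { parent      = id
    ; depth       = λ _ → 0
    ; root∈       = here refl
    ; unique      = [] ∷ []
    ; parent-in   = λ { (here refl) r≢r → ⊥-elim (r≢r refl) }
    ; parent-root = refl
    ; parent-adj  = λ { (here refl) r≢r → ⊥-elim (r≢r refl) }
    ; depth-<     = λ { (here refl) r≢r → ⊥-elim (r≢r refl) }
    ; adj-parent  = λ { (here refl) (here refl) a → ⊥-elim (adj⇒≢ G a refl) }
    ; path        = λ { (here refl) (here refl) r≢r → ⊥-elim (r≢r refl) }
    }

  module _ (acyclic : Acyclic G) {r : Fin n} {L : List (Fin n)} (R : Rooted r L) where
    open Rooted R

    -- Otherwise the path inside `L` from `p` to `p′` closes to a cycle through `v`.
    unique-neighbour : ∀ {v p p′} → v ∉ L → p ∈ L → p′ ∈ L → Adj G v p → Adj G v p′ → p ≡ p′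
    unique-neighbour {v} {p} {p′} v∉ p∈ p′∈ vp vp′ with p ≟ᶠ p′
    ... | yes eq = eq
    ... | no p≢ with path p∈ p′∈ p≢
    ... | mid , p! , walk , inL = ⊥-elim (acyclic _ (isCycle v p mid
            (All.map (λ { x∈ refl → v∉ x∈ }) inL ∷ p!) (vp , walk) (adj-sym G vp′)))

    extend : ∀ {v p} → v ∉ L → p ∈ L → Adj G v p → Rooted r (v ∷ L)
    extend {v} {p} v∉ p∈ vp = record
      { parent      = par
      ; depth       = dep
      ; root∈       = there root∈
      ; unique      = All.tabulate (λ { x∈ refl → v∉ x∈ }) ∷ unique
      ; parent-in   = λ
          { (here refl) _  → there (subst (_∈ L) (≡-sym par-v) p∈)
          ; (there u∈) u≢r → there (subst (_∈ L) (≡-sym (par-old u∈)) (parent-in u∈ u≢r)) }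
      ; parent-root = trans (par-old root∈) parent-root
      ; parent-adj  = λ
          { (here refl) _  → subst (Adj G v) (≡-sym par-v) vp
          ; (there u∈) u≢r → subst (Adj G _) (≡-sym (par-old u∈)) (parent-adj u∈ u≢r) }
      ; depth-<     = depth-<′
      ; adj-parent  = λ
          { (here refl) (here refl) a → ⊥-elim (adj⇒≢ G a refl)
          ; (here refl) (there u∈) a  → inj₂ (trans par-v (unique-neighbour v∉ p∈ u∈ vp a))
          ; (there u∈) (here refl) a  → inj₁ (trans par-v (unique-neighbour v∉ p∈ u∈ vp (adj-sym G a)))
          ; (there u∈) (there w∈) a   → old-adj u∈ w∈ (adj-parent u∈ w∈ a) }
      ; path        = path′
      }
      where
      par = override parent v p
      dep = override depth v (suc (depth p))

      par-v : par v ≡ p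
      par-v = override-≡ parent v p

      old≢ : ∀ {u} → u ∈ L → u ≢ v
      old≢ u∈ refl = v∉ u∈

      par-old : ∀ {u} → u ∈ L → par u ≡ parent u
      par-old u∈ = override-≢ parent p (old≢ u∈)

      dep-old : ∀ {u} → u ∈ L → dep u ≡ depth u
      dep-old u∈ = override-≢ depth (suc (depth p)) (old≢ u∈)

      depth-<′ : ∀ {u} → u ∈ v ∷ L → u ≢ r → dep (par u) < dep u
      depth-<′ (here refl) _ = subst₂ _<_
        (≡-sym (trans (cong dep par-v) (dep-old p∈))) (≡-sym (override-≡ depth v _)) ℕ.≤-refl
      depth-<′ (there u∈) u≢r = subst₂ _<_
        (≡-sym (trans (cong dep (par-old u∈)) (dep-old (parent-in u∈ u≢r)))) (≡-sym (dep-old u∈)) (depth-< u∈ u≢r)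

      old-adj : ∀ {u w} → u ∈ L → w ∈ L → parent w ≡ u ⊎ parent u ≡ w → par w ≡ u ⊎ par u ≡ w
      old-adj u∈ w∈ (inj₁ eq) = inj₁ (trans (par-old w∈) eq)
      old-adj u∈ w∈ (inj₂ eq) = inj₂ (trans (par-old u∈) eq)

      fresh : ∀ {xs} → All (_∈ L) xs → v ∉ xs
      fresh inL v∈ = v∉ (All.lookup inL v∈)

      path′ : ∀ {a b} → a ∈ v ∷ L → b ∈ v ∷ L → a ≢ b → PathIn (v ∷ L) a b
      path′ (here refl) (here refl) a≢b = ⊥-elim (a≢b refl)
      path′ {b = b} (here refl) (there b∈) a≢b with p ≟ᶠ b
      ... | yes refl = [] , (a≢b ∷ []) ∷ [] ∷ [] , (vp , tt) , here refl ∷ there b∈ ∷ []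
      ... | no p≢b with path p∈ b∈ p≢b
      ... | mid , p! , walk , inL =
        p ∷ mid , All.tabulate (λ { x∈ refl → fresh inL x∈ }) ∷ p! , (vp , walk) , here refl ∷ All.map there inL
      path′ {a = a} (there a∈) (here refl) a≢b with a ≟ᶠ p
      ... | yes refl = [] , (a≢b ∷ []) ∷ [] ∷ [] , (adj-sym G vp , tt) , there a∈ ∷ here refl ∷ []
      ... | no a≢p with path a∈ p∈ a≢p
      ... | mid , p! , walk , inL =
        mid ++ [ p ] , unique-∷ʳ p! (fresh inL) , walk-∷ʳ a mid walk (adj-sym G vp) ,
        All.++⁺ (All.map there inL) (here refl ∷ [])
      path′ (there a∈) (there b∈) a≢b with path a∈ b∈ a≢b
      ... | mid , p! , walk , inL = mid , p! , walk , All.map there inL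

  Spanning : Fin n → Set
  Spanning r = Σ (List (Fin n)) λ L → Rooted r L × (∀ v → v ∈ L)

  module _ (tree : IsTree G) (r : Fin n) where

    -- The fuel `m` bounds the number of vertices still missing. The path from the root to a missing
    -- vertex leaves `L` along some edge, whose outer end is attached next.
    complete : ∀ {L} m → n ≤ length L + m → Rooted r L → Spanning r
    complete {L} m bound R with all? (_∈? L)
    ... | yes all∈ = L , R , all∈
    ... | no ¬all∈ with ¬∀⟶∃¬ n _ (_∈? L) ¬all∈
    complete {L} zero bound R | no _ | u , u∉ = ⊥-elim (ℕ.<-irrefl refl (ℕ.≤-trans (s≤s bound′) (unique⇒length≤ u∷L!)))
      where
      bound′ : n ≤ length L
      bound′ = subst (n ≤_) (ℕ.+-identityʳ _) bound
      u∷L! : Unique (u ∷ L)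
      u∷L! = All.tabulate (λ { x∈ refl → u∉ x∈ }) ∷ Rooted.unique R
    complete {L} (suc m) bound R | no _ | u , u∉
      with proj₁ tree r u (λ { refl → u∉ (Rooted.root∈ R) })
    ... | _ , mid , refl , _ , walk with walk-leaves r mid walk (Rooted.root∈ R) u∉
    ... | x , y , x∈ , y∉ , xy =
      complete m (subst (n ≤_) (ℕ.+-suc _ m) bound) (extend (proj₂ tree) R y∉ x∈ (adj-sym G xy))

    spanning : Spanning r
    spanning = complete n (ℕ.m≤n⇒m≤1+n ℕ.≤-refl) (singleton r)

-- Rooted trees and their number of edges

record RootedTree {n : ℕ} (G : Graph n) : Set where
  field
    root        : Fin n
    parent      : Fin n → Fin n
    depth       : Fin n → ℕ
    parent-root : parent root ≡ root
    parent-adj  : ∀ {v} → v ≢ root → Adj G v (parent v)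
    depth-<     : ∀ {v} → v ≢ root → depth (parent v) < depth v
    adj-parent  : ∀ {u v} → Adj G u v → parent v ≡ u ⊎ parent u ≡ v

  -- The root is its own parent by convention, so it has to be excluded explicitly.
  Child : Fin n → Fin n → Set
  Child u v = v ≢ root × parent v ≡ u

  child? : ∀ u v → Dec (Child u v)
  child? u v = ¬? (v ≟ᶠ root) ×-dec (parent v ≟ᶠ u)

  child-adj : ∀ {u v} → Child u v → Adj G u v
  child-adj (v≢r , refl) = adj-sym G (parent-adj v≢r)

  child-depth : ∀ {u v} → Child u v → depth u < depth v
  child-depth (v≢r , refl) = depth-< v≢r

  child-asym : ∀ {u v} → Child u v → ¬ Child v u
  child-asym uv vu = ℕ.<-asym (child-depth uv) (child-depth vu)

  parent⇒child : ∀ {u v} → Adj G u v → parent v ≡ u → Child u v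
  parent⇒child a eq = (λ { refl → adj⇒≢ G a (trans (≡-sym eq) parent-root) }) , eq

  adj⇒child : ∀ {u v} → Adj G u v → Child u v ⊎ Child v u
  adj⇒child a with adj-parent a
  ... | inj₁ eq = inj₁ (parent⇒child a eq)
  ... | inj₂ eq = inj₂ (parent⇒child (adj-sym G a) eq)

rootedTree : ∀ {n} {G : Graph n} → IsTree G → Fin n → RootedTree G
rootedTree {G = G} tree r with spanning G tree r
... | L , R , all∈ = record
  { root        = r
  ; parent      = parent
  ; depth       = depth
  ; parent-root = parent-root
  ; parent-adj  = parent-adj (all∈ _)
  ; depth-<     = depth-< (all∈ _)
  ; adj-parent  = adj-parent (all∈ _) (all∈ _)
  }
  where open Rooted R

module _ {n : ℕ} {G : Graph n} (R : RootedTree G) where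
  open RootedTree R

  lowerEnd : Fin n × Fin n → Fin n
  lowerEnd (i , j) = if does (child? j i) then i else j

  lowerEnd-spec : ∀ {i j} → Adj G i j →
    (lowerEnd (i , j) ≡ i × Child j i) ⊎ (lowerEnd (i , j) ≡ j × Child i j)
  lowerEnd-spec {i} {j} a with adj⇒child a
  ... | inj₁ c rewrite dec-false (child? j i) (child-asym c) = inj₂ (refl , c)
  ... | inj₂ c rewrite dec-true (child? j i) c               = inj₁ (refl , c)

  -- The upper end is the parent of the lower one, so both edges have the same two ends. In the
  -- mixed cases they would be one pair in both orders, but `edges` lists only the numerically
  -- increasing one.
  lowerEnd-injective : ∀ {e f} → e ∈ edges G → f ∈ edges G → lowerEnd e ≡ lowerEnd f → e ≡ f
  lowerEnd-injective {i , j} {k , l} e∈ f∈ eq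
    with ∈-edges⁻ G e∈ | ∈-edges⁻ G f∈
  ... | i<j , ij | k<l , kl with lowerEnd-spec ij | lowerEnd-spec kl
  ... | inj₁ (p , _ , pj) | inj₁ (p′ , _ , pl) with trans (≡-sym p) (trans eq p′)
  ... | refl = cong (i ,_) (trans (≡-sym pj) pl)
  lowerEnd-injective {i , j} {k , l} e∈ f∈ eq | i<j , ij | k<l , kl | inj₁ (p , _ , pj) | inj₂ (p′ , _ , pk)
    with trans (≡-sym p) (trans eq p′)
  ... | refl with trans (≡-sym pj) pk
  ... | refl = ⊥-elim (ℕ.<-asym i<j k<l)
  lowerEnd-injective {i , j} {k , l} e∈ f∈ eq | i<j , ij | k<l , kl | inj₂ (p , _ , pi) | inj₁ (p′ , _ , pl)
    with trans (≡-sym p) (trans eq p′)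
  ... | refl with trans (≡-sym pi) pl
  ... | refl = ⊥-elim (ℕ.<-asym i<j k<l)
  lowerEnd-injective {i , j} {k , l} e∈ f∈ eq | i<j , ij | k<l , kl | inj₂ (p , _ , pi) | inj₂ (p′ , _ , pk)
    with trans (≡-sym p) (trans eq p′)
  ... | refl = cong (_, j) (trans (≡-sym pi) pk)

  lowerEnd≢root : ∀ {e} → e ∈ edges G → lowerEnd e ≢ root
  lowerEnd≢root {i , j} e∈ eq with lowerEnd-spec (proj₂ (∈-edges⁻ G e∈))
  ... | inj₁ (p , i≢r , _) = i≢r (trans (≡-sym p) eq)
  ... | inj₂ (p , j≢r , _) = j≢r (trans (≡-sym p) eq)

  ∈-lowerEnds : ∀ {v} → v ≢ root → v ∈ map lowerEnd (edges G)
  ∈-lowerEnds {v} v≢r with adj⇒∈-edges G (parent-adj v≢r)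
  ... | inj₁ e∈ with lowerEnd-spec (parent-adj v≢r)
  ...   | inj₁ (eq , _) = subst (_∈ _) eq (∈-map⁺ lowerEnd e∈)
  ...   | inj₂ (_ , c)  = ⊥-elim (child-asym c (v≢r , refl))
  ∈-lowerEnds {v} v≢r | inj₂ e∈ with lowerEnd-spec (adj-sym G (parent-adj v≢r))
  ...   | inj₁ (_ , c)  = ⊥-elim (child-asym c (v≢r , refl))
  ...   | inj₂ (eq , _) = subst (_∈ _) eq (∈-map⁺ lowerEnd e∈)

  -- The root together with the lower ends of all edges lists every vertex exactly once.
  edge-count : suc (length (edges G)) ≡ n
  edge-count = trans (cong suc (≡-sym (length-map lowerEnd (edges G)))) (ℕ.≤-antisym
      (unique⇒length≤ vertices!)
      (complete⇒length≥ vertices-complete))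
    where
    vertices : List (Fin n)
    vertices = root ∷ map lowerEnd (edges G)
    vertices! : Unique vertices
    vertices! = All.map⁺ (All.tabulate (λ e∈ → lowerEnd≢root e∈ ∘ ≡-sym)) ∷
      unique-map lowerEnd lowerEnd-injective (edges-unique G)
    vertices-complete : ∀ v → v ∈ vertices
    vertices-complete v with v ≟ᶠ root
    ... | yes eq = here eq
    ... | no v≢r = there (∈-lowerEnds v≢r)

-- Matchings and mates

-- A matching may store an edge in either orientation.
Mated : {n : ℕ} → List (Fin n × Fin n) → Fin n → Fin n → Set
Mated M v x = (v , x) ∈ M ⊎ (x , v) ∈ M

module _ {n : ℕ} where

  mated-∷ : ∀ {e} {M : List (Fin n × Fin n)} {v x} → Mated M v x → Mated (e ∷ M) v x
  mated-∷ (inj₁ m) = inj₁ (there m)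
  mated-∷ (inj₂ m) = inj₂ (there m)

  mated-∷⁻ : ∀ {i j} {M : List (Fin n × Fin n)} {v x} → Mated ((i , j) ∷ M) v x →
    (v ≡ i × x ≡ j) ⊎ (v ≡ j × x ≡ i) ⊎ Mated M v x
  mated-∷⁻ (inj₁ (here refl)) = inj₁ (refl , refl)
  mated-∷⁻ (inj₁ (there m))   = inj₂ (inj₂ (inj₁ m))
  mated-∷⁻ (inj₂ (here refl)) = inj₂ (inj₁ (refl , refl))
  mated-∷⁻ (inj₂ (there m))   = inj₂ (inj₂ (inj₂ m))

  mated⇒∈ : ∀ {M : List (Fin n × Fin n)} {v x} → Mated M v x → v ∈ endpoints M
  mated⇒∈ {_ ∷ M} m with mated-∷⁻ m
  ... | inj₁ (refl , _)        = here refl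
  ... | inj₂ (inj₁ (refl , _)) = there (here refl)
  ... | inj₂ (inj₂ m′)         = there (there (mated⇒∈ m′))
  mated⇒∈ {[]} (inj₁ ())
  mated⇒∈ {[]} (inj₂ ())

  ∈⇒mated : ∀ {M : List (Fin n × Fin n)} {v} → v ∈ endpoints M → ∃ (Mated M v)
  ∈⇒mated {_ ∷ M} (here refl)         = _ , inj₁ (here refl)
  ∈⇒mated {_ ∷ M} (there (here refl)) = _ , inj₂ (here refl)
  ∈⇒mated {_ ∷ M} (there (there v∈))  = let (x , m) = ∈⇒mated v∈ in x , mated-∷ m

  mated-unique : ∀ {M : List (Fin n × Fin n)} {v x y} → Unique (endpoints M) →
    Mated M v x → Mated M v y → x ≡ y
  mated-unique {[]} _ (inj₁ ())
  mated-unique {[]} _ (inj₂ ())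
  mated-unique {_ ∷ M} ((i≢j ∷ i∉) ∷ j∉ ∷ M!) m m′ with mated-∷⁻ m | mated-∷⁻ m′
  ... | inj₁ (refl , refl)        | inj₁ (_ , refl)           = refl
  ... | inj₁ (refl , refl)        | inj₂ (inj₁ (eq , _))      = ⊥-elim (i≢j eq)
  ... | inj₁ (refl , refl)        | inj₂ (inj₂ t)             = ⊥-elim (All.lookup i∉ (mated⇒∈ t) refl)
  ... | inj₂ (inj₁ (refl , refl)) | inj₁ (eq , _)             = ⊥-elim (i≢j (≡-sym eq))
  ... | inj₂ (inj₁ (refl , refl)) | inj₂ (inj₁ (_ , refl))    = refl
  ... | inj₂ (inj₁ (refl , refl)) | inj₂ (inj₂ t)             = ⊥-elim (All.lookup j∉ (mated⇒∈ t) refl)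
  ... | inj₂ (inj₂ t)             | inj₁ (refl , _)           = ⊥-elim (All.lookup i∉ (mated⇒∈ t) refl)
  ... | inj₂ (inj₂ t)             | inj₂ (inj₁ (refl , _))    = ⊥-elim (All.lookup j∉ (mated⇒∈ t) refl)
  ... | inj₂ (inj₂ t)             | inj₂ (inj₂ t′)            = mated-unique M! t t′

  -- The permutation yields both the disjointness of the remaining edges from `v` and `x` and the
  -- change of `weight`.
  mated-remove : ∀ {M : List (Fin n × Fin n)} {v x} → Mated M v x →
    ∃ λ M′ → M′ ⊆ M × length M ≡ suc (length M′) × endpoints M ↭ v ∷ x ∷ endpoints M′
  mated-remove {[]} (inj₁ ())
  mated-remove {[]} (inj₂ ())
  mated-remove {(i , j) ∷ M} m with mated-∷⁻ m
  ... | inj₁ (refl , refl)        = M , there , refl , ↭-refl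
  ... | inj₂ (inj₁ (refl , refl)) = M , there , refl , ↭-swap _ _ ↭-refl
  ... | inj₂ (inj₂ t) with mated-remove t
  ... | M′ , sub , len , perm = (i , j) ∷ M′ , (λ { (here eq) → here eq ; (there e∈) → there (sub e∈) }) ,
    cong suc len , ↭-trans (↭-prep i (↭-prep j perm)) (shifts (i ∷ j ∷ []) (_ ∷ _ ∷ []))

  mated-sym : ∀ {M : List (Fin n × Fin n)} {v x} → Mated M v x → Mated M x v
  mated-sym (inj₁ m) = inj₂ m
  mated-sym (inj₂ m) = inj₁ m

  EndpointDisjoint : Fin n × Fin n → Fin n × Fin n → Set
  EndpointDisjoint (i , j) (k , l) = (i ≢ k × i ≢ l) × (j ≢ k × j ≢ l)

  endpoints-unique : ∀ {E : List (Fin n × Fin n)} → (∀ {i j} → (i , j) ∈ E → i ≢ j) →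
    AllPairs EndpointDisjoint E → Unique (endpoints E)
  endpoints-unique loopless [] = []
  endpoints-unique {(i , j) ∷ E} loopless (d ∷ ds) =
    (loopless (here refl) ∷ All.tabulate (away (All.map proj₁ d))) ∷
    All.tabulate (away (All.map proj₂ d)) ∷
    endpoints-unique (loopless ∘ there) ds
    where
    away : ∀ {x} {E′ : List (Fin n × Fin n)} → All (λ e → x ≢ proj₁ e × x ≢ proj₂ e) E′ →
      ∀ {y} → y ∈ endpoints E′ → x ≢ y
    away ((x≢ , _) ∷ _) (here refl)         = x≢
    away ((_ , x≢) ∷ _) (there (here refl)) = x≢
    away (_ ∷ rest)     (there (there y∈))  = away rest y∈

  mated-adj : ∀ {G : Graph n} {M v x} → IsMatching G M → Mated M v x → Adj G v x
  mated-adj {G} (as , _) (inj₁ m) = All.lookup as m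
  mated-adj {G} (as , _) (inj₂ m) = adj-sym G (All.lookup as m)

  unique-↭ : ∀ {xs ys : List (Fin n)} → xs ↭ ys → Unique xs → Unique ys
  unique-↭ p = SetoidPerm.Unique-resp-↭ (setoid (Fin n)) (↭⇒↭ₛ p)

-- A maximum matching that covers every vertex with a child

module _ {n : ℕ} {G : Graph n} (R : RootedTree G) (a : ℕ) (maximum : ∀ M → IsMatching G M → length M ≤ a) where
  open RootedTree R
  open DecMembership (_≟ᶠ_ {n}) using (_∈?_)

  CoversParents : List (Fin n × Fin n) → Set
  CoversParents M = ∀ {v u} → Child v u → v ∈ endpoints M

  -- The measure for termination: each push exchanges a covered vertex for its grandparent.
  weight : List (Fin n × Fin n) → ℕ
  weight M = sum (map depth (endpoints M))

  -- The uncovered vertex v is pushed down to a grandchild, the mate x of its child u.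
  pushDown : ∀ M → IsMatching G M → length M ≡ a → ∀ {v u} → Child v u → v ∉ endpoints M →
    ∃ λ M′ → IsMatching G M′ × length M′ ≡ a × weight M′ < weight M
  pushDown M Mm@(as , M!) len {v} {u} c v∉ with u ∈? endpoints M
  -- With both ends uncovered, the edge `(v , u)` would enlarge a maximum matching.
  ... | no u∉ = ⊥-elim (ℕ.<-irrefl refl (subst (λ l → suc l ≤ a) len
          (maximum ((v , u) ∷ M)
            ( child-adj c ∷ as
            , (adj⇒≢ G (child-adj c) ∷ All.tabulate (λ { x∈ refl → v∉ x∈ }))
              ∷ All.tabulate (λ { x∈ refl → u∉ x∈ }) ∷ M!))))
  ... | yes u∈ with ∈⇒mated u∈
  ... | x , m with mated-remove m
  ... | M′ , sub , len′ , perm with adj⇒child (mated-adj {G = G} Mm m) | unique-↭ perm M!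
  -- The mate of `u` is not its parent, which is the uncovered `v`.
  ... | inj₂ (_ , refl) | _ = ⊥-elim (v∉ (subst (_∈ endpoints M) (proj₂ c) (∈-resp-↭ (↭-sym perm) (there (here refl)))))
  ... | inj₁ c′ | (_ ∷ u∉) ∷ x∉ ∷ M′! =
    (v , u) ∷ M′ ,
    ( child-adj c ∷ All.tabulate (All.lookup as ∘ sub)
    , (adj⇒≢ G (child-adj c) ∷ All.tabulate (λ { y∈ refl → v∉ (∈-resp-↭ (↭-sym perm) (there (there y∈))) })) ∷ u∉ ∷ M′!) ,
    trans (≡-sym len′) len ,
    -- The ends `v`, `u` replace `u`, `x`; each is compared with the one in its place, one level
    -- below it.
    subst (weight ((v , u) ∷ M′) <_) (≡-sym (sum-↭ (↭-map depth perm)))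
      (ℕ.+-mono-<-≤ (child-depth c) (ℕ.+-monoˡ-≤ _ (ℕ.<⇒≤ (child-depth c′))))

  coverParents : ∀ M → IsMatching G M → length M ≡ a → Acc _<_ (weight M) →
    ∃ λ M′ → IsMatching G M′ × length M′ ≡ a × CoversParents M′
  coverParents M Mm len (acc rs) with any? (λ v → any? (λ u → child? v u ×-dec ¬? (v ∈? endpoints M)))
  ... | no ¬hole = M , Mm , len , λ {v} {u} c → decidable-stable (v ∈? endpoints M) (λ v∉ → ¬hole (v , u , c , v∉))
  ... | yes (v , u , c , v∉) with pushDown M Mm len c v∉
  ... | M′ , Mm′ , len′ , lt = coverParents M′ Mm′ len′ (rs lt)

-- The optimal colouring, built from the root downwards

transpose-injective : ∀ {m} (i j : Fin m) {k l} → transpose i j k ≡ transpose i j l → k ≡ l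
transpose-injective i j eq =
  trans (≡-sym (transpose-inverse j i)) (trans (cong (transpose j i) eq) (transpose-inverse j i))

transpose-left : ∀ {m} (i j : Fin m) → transpose i j i ≡ j
transpose-left i j rewrite dec-true (i ≟ᶠ i) refl = refl

transpose-fix : ∀ {m} (i j : Fin m) {k} → k ≢ i → k ≢ j → transpose i j k ≡ k
transpose-fix i j {k} k≢i k≢j rewrite dec-false (k ≟ᶠ i) k≢i | dec-false (k ≟ᶠ j) k≢j = refl

LocallyProper : ∀ {n q} {G : Graph n} → Recolouring G q → Set
LocallyProper {n} {G = G} c = ∀ {v a b : Fin n} → Adj G v a → Adj G v b → col c v a ≡ col c v b → a ≡ b

module Colouring {n : ℕ} {G : Graph n} (R : RootedTree G) {M : List (Fin n × Fin n)} (Mm : IsMatching G M)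
  (covers : ∀ {v u} → RootedTree.Child R v u → v ∈ endpoints M)
  {q : ℕ} (degree≤ : ∀ v → degree G v ≤ suc q) where

  open RootedTree R
  open DecMembership (_≟ᶠ_ {n}) using (_∈?_)

  Covered : Fin n → Set
  Covered v = v ∈ endpoints M

  mate : Fin n → Fin n
  mate v with v ∈? endpoints M
  ... | yes v∈ = proj₁ (∈⇒mated {M = M} v∈)
  -- As its own mate, an uncovered vertex has the default rank 0, so the swap in `mateFirst` is the
  -- identity there.
  ... | no _   = v

  mate-mated : ∀ {v} → Covered v → Mated M v (mate v)
  mate-mated {v} v∈ with v ∈? endpoints M
  ... | yes v∈′ = proj₂ (∈⇒mated {M = M} v∈′)
  ... | no v∉   = ⊥-elim (v∉ v∈)

  mate-adj : ∀ {v} → Covered v → Adj G v (mate v)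
  mate-adj v∈ = mated-adj {G = G} Mm (mate-mated v∈)

  mate-involutive : ∀ {v} → Covered v → mate (mate v) ≡ v
  mate-involutive v∈ = mated-unique (proj₂ Mm) (mate-mated (mated⇒∈ m)) m
    where m = mated-sym (mate-mated v∈)

  rank : Fin n → Fin n → Fin (suc q)
  rank p u with T? (adj G p u)
  ... | yes a = inject≤ (Any.index (∈-neighbours G a)) (degree≤ p)
  ... | no _  = fzero

  rank-injective : ∀ {p u w} → Adj G p u → Adj G p w → rank p u ≡ rank p w → u ≡ w
  rank-injective {p} {u} {w} pu pw eq with T? (adj G p u) | T? (adj G p w)
  ... | no ¬pu | _      = ⊥-elim (¬pu pu)
  ... | yes _  | no ¬pw = ⊥-elim (¬pw pw)
  ... | yes x  | yes y  = index-injective (∈-neighbours G x) (∈-neighbours G y)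
                            (inject≤-injective (degree≤ p) (degree≤ p) _ _ eq)

  mateFirst : Fin n → Fin n → Fin (suc q)
  mateFirst p u = transpose (rank p (mate p)) fzero (rank p u)

  mateFirst-injective : ∀ {p u w} → Adj G p u → Adj G p w → mateFirst p u ≡ mateFirst p w → u ≡ w
  mateFirst-injective pu pw eq = rank-injective pu pw (transpose-injective _ fzero eq)

  mateFirst-mate : ∀ p → mateFirst p (mate p) ≡ fzero
  mateFirst-mate p = transpose-left (rank p (mate p)) fzero

  localFrom : ∀ p → Acc _<_ (depth p) → Fin n → Fin (suc q)
  localFrom p (acc rs) u with p ≟ᶠ root
  ... | yes _  = mateFirst p u
  ... | no p≢r = transpose (mateFirst p (parent p)) (localFrom (parent p) (rs (depth-< p≢r)) p) (mateFirst p u)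

  -- Unfolding the recursion at `p` produces another accessibility proof for the parent than the one
  -- fixed in `local`.
  localFrom-irrelevant : ∀ p (r s : Acc _<_ (depth p)) u → localFrom p r u ≡ localFrom p s u
  localFrom-irrelevant p (acc rs) (acc ss) u with p ≟ᶠ root
  ... | yes _  = refl
  ... | no p≢r = cong (λ c → transpose (mateFirst p (parent p)) c (mateFirst p u))
                   (localFrom-irrelevant (parent p) (rs (depth-< p≢r)) (ss (depth-< p≢r)) p)

  -- The colours around p: the mate gets 0, and colours are swapped so that the
  -- edge to the parent keeps the colour it was given at the parent.
  local : Fin n → Fin n → Fin (suc q)
  local p = localFrom p (<-wellFounded (depth p))

  localFrom-root : ∀ r u → localFrom root r u ≡ mateFirst root u
  localFrom-root (acc rs) u with root ≟ᶠ root
  ... | yes _  = refl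
  ... | no r≢r = ⊥-elim (r≢r refl)

  localFrom-nonroot : ∀ {p} → p ≢ root → ∀ r s u →
    localFrom p r u ≡ transpose (mateFirst p (parent p)) (localFrom (parent p) s p) (mateFirst p u)
  localFrom-nonroot {p} p≢r (acc rs) s u with p ≟ᶠ root
  ... | yes eq  = ⊥-elim (p≢r eq)
  ... | no p≢r′ = cong (λ c → transpose (mateFirst p (parent p)) c (mateFirst p u))
                    (localFrom-irrelevant (parent p) (rs (depth-< p≢r′)) s p)

  local-root : ∀ u → local root u ≡ mateFirst root u
  local-root = localFrom-root _

  local-nonroot : ∀ {p} → p ≢ root → ∀ u →
    local p u ≡ transpose (mateFirst p (parent p)) (local (parent p) p) (mateFirst p u)
  local-nonroot p≢r = localFrom-nonroot p≢r _ _

  root⊎nonroot : ∀ p → p ≡ root ⊎ p ≢ root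
  root⊎nonroot p with p ≟ᶠ root
  ... | yes eq = inj₁ eq
  ... | no p≢r = inj₂ p≢r

  local-injective : ∀ {p u w} → Adj G p u → Adj G p w → local p u ≡ local p w → u ≡ w
  local-injective {p} {u} {w} pu pw eq with root⊎nonroot p
  ... | inj₁ refl = mateFirst-injective pu pw (trans (≡-sym (local-root u)) (trans eq (local-root w)))
  ... | inj₂ p≢r  = mateFirst-injective pu pw (transpose-injective (mateFirst p (parent p)) (local (parent p) p)
                     (trans (≡-sym (local-nonroot p≢r u)) (trans eq (local-nonroot p≢r w))))

  local-parent : ∀ {p} → p ≢ root → local p (parent p) ≡ local (parent p) p
  local-parent {p} p≢r = trans (local-nonroot p≢r (parent p)) (transpose-left (mateFirst p (parent p)) _)

  -- Induction towards the root. If the mate is the parent, the edge received 0 there. Otherwise the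
  -- swap at `p` has to leave 0 alone, so neither of the two swapped colours may be 0.
  local-mate : ∀ p → Acc _<_ (depth p) → Covered p → local p (mate p) ≡ fzero
  local-mate p (acc rs) p∈ with root⊎nonroot p
  ... | inj₁ refl = trans (local-root (mate root)) (mateFirst-mate root)
  ... | inj₂ p≢r with local-mate (parent p) (rs (depth-< p≢r)) (covers (p≢r , refl))
  ...   | ih with parent p ≟ᶠ mate p
  ...     | yes eq = begin
    local p (mate p)                   ≡⟨ cong (local p) eq ⟨
    local p (parent p)                 ≡⟨ local-parent p≢r ⟩
    local (parent p) p                 ≡⟨ cong (local (parent p)) mate-parent ⟨
    local (parent p) (mate (parent p)) ≡⟨ ih ⟩
    fzero ∎
    where
    open ≡-Reasoning
    mate-parent : mate (parent p) ≡ p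
    mate-parent = trans (cong mate eq) (mate-involutive p∈)
  ...     | no parent≢mate = begin
    local p (mate p)
      ≡⟨ local-nonroot p≢r (mate p) ⟩
    transpose (mateFirst p (parent p)) (local (parent p) p) (mateFirst p (mate p))
      ≡⟨ cong (transpose _ _) (mateFirst-mate p) ⟩
    transpose (mateFirst p (parent p)) (local (parent p) p) fzero
      ≡⟨ transpose-fix (mateFirst p (parent p)) (local (parent p) p) ≢rank ≢colour ⟩
    fzero ∎
    where
    open ≡-Reasoning
    parent∈ : Covered (parent p)
    parent∈ = covers (p≢r , refl)
    -- Before the swap, 0 belongs to the mate of `p` alone.
    ≢rank : fzero ≢ mateFirst p (parent p)
    ≢rank eq = parent≢mate (mateFirst-injective (parent-adj p≢r) (mate-adj p∈)
      (trans (≡-sym eq) (≡-sym (mateFirst-mate p))))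
    -- At the parent, 0 is taken by the parent's own mate, which exists because `covers` applies to
    -- it.
    ≢colour : fzero ≢ local (parent p) p
    ≢colour eq = parent≢mate (trans (≡-sym (mate-involutive parent∈))
      (cong mate (local-injective (mate-adj parent∈) (child-adj (p≢r , refl)) (trans ih eq))))

  -- The upper end decides. The value 0 off the edges is arbitrary.
  colour : Fin n → Fin n → Fin (suc q)
  colour u v =
    if does (child? u v) then local u v else
    if does (child? v u) then local v u else fzero

  colour-sym : ∀ u v → colour u v ≡ colour v u
  colour-sym u v with child? u v | child? v u
  ... | yes c | _      rewrite dec-true (child? u v) c | dec-false (child? v u) (child-asym c) = refl
  ... | no _  | yes c  rewrite dec-true (child? v u) c | dec-false (child? u v) (child-asym c) = refl
  ... | no ¬c | no ¬c′ rewrite dec-false (child? u v) ¬c | dec-false (child? v u) ¬c′ = refl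

  -- The lower end agrees with the upper one by `local-parent`; hence properness can be checked
  -- around a single vertex.
  colour-local : ∀ {u v} → Adj G u v → colour u v ≡ local u v
  colour-local {u} {v} a with adj⇒child a
  ... | inj₁ c rewrite dec-true (child? u v) c = refl
  ... | inj₂ c@(u≢r , refl) rewrite dec-false (child? u v) (child-asym c) | dec-true (child? v u) c =
    ≡-sym (local-parent u≢r)

  recolouring : Recolouring G q
  recolouring = record { col = colour ; colSym = colour-sym }

  recolouring-proper : LocallyProper recolouring
  recolouring-proper va vb eq =
    local-injective va vb (trans (≡-sym (colour-local va)) (trans eq (colour-local vb)))

  covered⇒zero : ∀ {v} → Covered v → Adj G v (mate v) × colour v (mate v) ≡ fzero
  covered⇒zero {v} v∈ = mate-adj v∈ ,
    trans (colour-local (mate-adj v∈)) (local-mate v (<-wellFounded _) v∈)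

-- Proper connection versus proper colouring; the edges of colour 0

module _ {n q : ℕ} {G : Graph n} (c : Recolouring G q) where

  proper⇒properSeq : LocallyProper c → ∀ xs → Unique xs → IsWalk G xs → ProperlyColouredSeq c xs
  proper⇒properSeq proper [] _ _ = tt
  proper⇒properSeq proper (x ∷ []) _ _ = tt
  proper⇒properSeq proper (x ∷ y ∷ []) _ _ = tt
  proper⇒properSeq proper (x ∷ y ∷ z ∷ r) ((_ ∷ x≢z ∷ _) ∷ p!) (xy , walk@(yz , _)) =
    (λ eq → x≢z (proper (adj-sym G xy) yz (trans (colSym c y x) eq))) ,
    proper⇒properSeq proper (y ∷ z ∷ r) p! walk

  proper⇒connected : Connected G → LocallyProper c → ProperlyConnected c
  proper⇒connected conn proper u v u≢v with conn u v u≢v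
  ... | xs , p@(_ , _ , p! , walk) = xs , p , proper⇒properSeq proper xs p! walk

  -- Two edges va, vb of one colour: the path from a to b must be a v b, as
  -- otherwise v closes a cycle with it or with one of its two halves.
  connected⇒proper : Acyclic G → ProperlyConnected c → LocallyProper c
  connected⇒proper acyclic conn {v} {a} {b} va vb eq with a ≟ᶠ b
  ... | yes a≡b = a≡b
  ... | no a≢b with conn a b a≢b
  ... | xs , (mid , refl , p! , walk) , coloured with v ∈? mid
    where open DecMembership (_≟ᶠ_ {n}) using (_∈?_)
  ... | no v∉ = ⊥-elim (acyclic _ (isCycle G v a mid
          (All.tabulate (λ { x∈ refl → v∉path x∈ }) ∷ p!) (va , walk) (adj-sym G vb)))
    where
    v∉path : v ∉ a ∷ mid ++ [ b ]
    v∉path (here refl) = adj⇒≢ G va refl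
    v∉path (there x∈) with ∈-++⁻ mid x∈
    ... | inj₁ v∈          = v∉ v∈
    ... | inj₂ (here refl) = adj⇒≢ G vb refl
  ... | yes v∈ with ∈-∃++ v∈
  ... | [] , [] , refl = ⊥-elim (proj₁ coloured (trans (colSym c a v) eq))
  ... | [] , z ∷ r , refl = ⊥-elim (acyclic _ (isCycle G v z r (AllPairs.tail p!) (proj₂ walk) (adj-sym G vb)))
  ... | x ∷ l , r , refl rewrite ++-assoc l (v ∷ r) [ b ] = ⊥-elim (acyclic _ (isCycle G a x l
          (proj₁ (unique-split (a ∷ x ∷ l) v (r ++ [ b ]) p!))
          (proj₁ (walk-split G a (x ∷ l) v (r ++ [ b ]) walk)) va))

  zeroEdge : Fin n × Fin n → Bool
  zeroEdge (i , j) = does (col c i j ≟ᶠ fzero)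

  zeroEdges : List (Fin n × Fin n)
  zeroEdges = filterᵇ zeroEdge (edges G)

  recoloured+zeroEdges : recoloured c + length zeroEdges ≡ length (edges G)
  recoloured+zeroEdges = length-filter-complement zeroEdge (edges G)

  ∈-zeroEdges⁻ : ∀ {i j} → (i , j) ∈ zeroEdges → toℕ i < toℕ j × Adj G i j × col c i j ≡ fzero
  ∈-zeroEdges⁻ {i} {j} e∈ with ∈-filter⁻ (T? ∘ zeroEdge) {xs = edges G} e∈
  ... | e∈G , t with col c i j ≟ᶠ fzero
  ... | yes eq = let (lt , ij) = ∈-edges⁻ G e∈G in lt , ij , eq

  ∈-zeroEdges⁺ : ∀ {i j} → (i , j) ∈ edges G → col c i j ≡ fzero → (i , j) ∈ zeroEdges
  ∈-zeroEdges⁺ {i} {j} e∈ eq =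
    ∈-filter⁺ (T? ∘ zeroEdge) e∈ (subst T (≡-sym (dec-true (col c i j ≟ᶠ fzero) eq)) tt)

  -- At a shared end, properness makes the other ends equal too. If the shared end is first in one
  -- pair and second in the other, the pairs are reverses of each other, against the order kept in
  -- `edges`.
  zeroEdges-disjoint : LocallyProper c → ∀ {e f} → e ∈ zeroEdges → f ∈ zeroEdges → e ≢ f → EndpointDisjoint e f
  zeroEdges-disjoint proper {i , j} {k , l} e∈ f∈ e≢f with ∈-zeroEdges⁻ e∈ | ∈-zeroEdges⁻ f∈
  ... | i<j , ij , ij0 | k<l , kl , kl0 =
    ( (λ { refl → e≢f (cong (i ,_) (proper ij kl (trans ij0 (≡-sym kl0)))) })
    , (λ { refl → crossed i<j k<l (proper ij (adj-sym G kl) (trans ij0 (≡-sym (flip0 kl0)))) }))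
    , (λ { refl → crossed k<l i<j (proper kl (adj-sym G ij) (trans kl0 (≡-sym (flip0 ij0)))) })
    , (λ { refl → e≢f (cong (_, j) (proper (adj-sym G ij) (adj-sym G kl) (trans (flip0 ij0) (≡-sym (flip0 kl0))))) })
    where
    flip0 : ∀ {u v} → col c u v ≡ fzero → col c v u ≡ fzero
    flip0 eq = trans (colSym c _ _) eq
    crossed : ∀ {x y z} → toℕ x < toℕ y → toℕ z < toℕ x → y ≡ z → ⊥
    crossed x<y z<x refl = ℕ.<-asym x<y z<x

  zeroEdges-matching : LocallyProper c → IsMatching G zeroEdges
  zeroEdges-matching proper =
    All.tabulate (λ { {i , j} e∈ → proj₁ (proj₂ (∈-zeroEdges⁻ e∈)) }) ,
    endpoints-unique (λ e∈ → adj⇒≢ G (proj₁ (proj₂ (∈-zeroEdges⁻ e∈))))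
      (allPairs-map∈ (zeroEdges-disjoint proper) (filter⁺ (T? ∘ zeroEdge) (edges-unique G)))

  ∈-endpoints-zeroEdges : ∀ {u v} → Adj G u v → col c u v ≡ fzero → u ∈ endpoints zeroEdges
  ∈-endpoints-zeroEdges a eq with adj⇒∈-edges G a
  ... | inj₁ e∈ = mated⇒∈ (inj₁ (∈-zeroEdges⁺ e∈ eq))
  ... | inj₂ e∈ = mated⇒∈ (inj₂ (∈-zeroEdges⁺ e∈ (trans (colSym c _ _) eq)))

  Δ≤colours : LocallyProper c → Δ G ≤ suc q
  Δ≤colours proper = Δ≤ G λ v → subst (_≤ suc q) (length-map (col c v) (neighbours G v))
    (unique⇒length≤ (unique-map (col c v)
      (λ x∈ y∈ → proper (∈-neighbours⁻ G x∈) (∈-neighbours⁻ G y∈)) (neighbours-unique G v)))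

-- Counting: both bounds are attained

length-endpoints : ∀ {n} (E : List (Fin n × Fin n)) → length (endpoints E) ≡ length E * 2
length-endpoints []      = refl
length-endpoints (_ ∷ E) = cong (suc ∘ suc) (length-endpoints E)

-- Comparing ends rather than edges makes the orientation of the pairs irrelevant.
endpoints-⊆⇒length≤ : ∀ {n} {E F : List (Fin n × Fin n)} →
  Unique (endpoints E) → endpoints E ⊆ endpoints F → length E ≤ length F
endpoints-⊆⇒length≤ {E = E} {F} E! sub = ℕ.*-cancelʳ-≤ (length E) (length F) 2
  (subst₂ _≤_ (length-endpoints E) (length-endpoints F) (unique-⊆⇒length≤ E! sub))

-- This lets Δ be written as `suc q`, where `q` is the number of new colours to use.
1≤Δ : ∀ {m} {G : Graph (suc (suc m))} → Connected G → 1 ≤ Δ G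
1≤Δ {G = G} connected with connected fzero (fsuc fzero) (λ ())
... | _ , []    , refl , _ , (a , _) = ℕ.≤-trans (1≤degree G a) (degree≤Δ G fzero)
... | _ , _ ∷ _ , refl , _ , (a , _) = ℕ.≤-trans (1≤degree G a) (degree≤Δ G fzero)

-- The cost of any recolouring, free of subtraction: `r` edges recoloured, `z` left at 0. One unit
-- of the 2 comes from the n - 1 edges, the other from colour 0 among the `suc q` colours.
cost-identity : ∀ r q z {e n} → r + z ≡ e → suc e ≡ n → r + q + 2 + z ≡ n + suc q
cost-identity r q z refl refl = solve 3 (λ r q z → r :+ q :+ con 2 :+ z := con 1 :+ (r :+ z) :+ (con 1 :+ q)) refl r q z
  where open +-*-Solver

theorem9 : (n : ℕ) → 2 ≤ n → (T : Graph n) → IsTree T →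
    (a : ℕ) → IsMatchingNumber T a →
    Σ ℕ λ k → IsPcOpt T k × k + 2 + a ≡ n + Δ T
theorem9 n@(suc (suc _)) (s≤s (s≤s z≤n)) T tree@(connected , acyclic) a ((M₀ , Mm₀ , len₀) , maximum)
  with rootedTree tree fzero | Δ T in Δ≡ | 1≤Δ {G = T} connected
... | R | suc q | _ with coverParents R a maximum M₀ Mm₀ len₀ (<-wellFounded _)
... | M , Mm , len , covers =
  k , ((q , recolouring , proper⇒connected recolouring connected recolouring-proper , refl) , optimal) , k≡
  where
  open Colouring R Mm covers (λ v → subst (degree T v ≤_) Δ≡ (degree≤Δ T v))

  k : ℕ
  k = recoloured recolouring + q

  -- The edges of colour 0 form a matching, and they cover every vertex that `M` covers.
  zeros≡a : length (zeroEdges recolouring) ≡ a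
  zeros≡a = ℕ.≤-antisym (maximum _ (zeroEdges-matching recolouring recolouring-proper))
    (subst (_≤ length (zeroEdges recolouring)) len (endpoints-⊆⇒length≤ {E = M} {zeroEdges recolouring} (proj₂ Mm)
      (λ v∈ → let (vm , vm0) = covered⇒zero v∈ in ∈-endpoints-zeroEdges recolouring vm vm0)))

  k≡ : k + 2 + a ≡ n + suc q
  k≡ = subst (λ z → k + 2 + z ≡ n + suc q) zeros≡a
    (cost-identity (recoloured recolouring) q (length (zeroEdges recolouring)) (recoloured+zeroEdges recolouring) (edge-count R))

  optimal : ∀ q′ (c : Recolouring T q′) → ProperlyConnected c → k ≤ recoloured c + q′
  optimal q′ c pc = ℕ.+-cancelʳ-≤ 2 k _ (ℕ.+-cancelʳ-≤ a (k + 2) _ (begin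
    k + 2 + a                                    ≡⟨ k≡ ⟩
    n + suc q                                    ≤⟨ ℕ.+-monoʳ-≤ n (subst (_≤ suc q′) Δ≡ (Δ≤colours c proper)) ⟩
    n + suc q′                                   ≡⟨ cost-identity (recoloured c) q′ (length (zeroEdges c)) (recoloured+zeroEdges c) (edge-count R) ⟨
    recoloured c + q′ + 2 + length (zeroEdges c) ≤⟨ ℕ.+-monoʳ-≤ (recoloured c + q′ + 2) (maximum _ (zeroEdges-matching c proper)) ⟩
    recoloured c + q′ + 2 + a                    ∎))
    where
    open ℕ.≤-Reasoning
    proper : LocallyProper c
    proper = connected⇒proper c acyclic pc
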